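{- Let $\alpha=p/q$, where $p,q$ are fixed positive integers with $p<q/2$, and let $0<c\le 1$ be a constant. For $i=1,\ldots,k$, let player $i$ hold a set $A_i\subset[n]=\{1,2,\ldots,n\}$ that is disjoint from any other player's set. Assume that $t=\left|\bigcup_{i=1}^k A_i\right|\ge cn$. Put $\ell=\left\lceil \log\frac{2q}{c}\right\rceil$. Then an $(\alpha t,\alpha t)$-mediocre element of $\bigcup_{i=1}^k A_i$ can be found by a deterministic protocol with communication complexity $O(\ell\cdot k\log n)=O(k\log n)$.
   Context: Multiparty communication model: each of the $k$ players knows only his/her own input $A_i$ (and the public parameters $n,k,\alpha,c$). Players communicate by broadcasting bits: every message sent by one player is seen by all players (blackboard). A deterministic protocol specifies, as a function of the messages sent so far, who speaks next, and each message is a function of the speaker's own input and the messages so far. At the end of the protocol the required output is known to the players. The communication complexity of a protocol is the maximum, over all admissible inputs, of the total number of bits broadcast; local computation is free. Mediocre element: an element of a finite totally ordered set $S$ is $(i,j)$-mediocre if it is neither among the top (i.e., largest) $i$ nor among the bottom (i.e., smallest) $j$ elements of $S$. Floors are omitted in the notation: $(\alpha t,\alpha t)$-mediocre means $(\lfloor\alpha t\rfloor,\lfloor\alpha t\rfloor)$-mediocre. The sets $A_i$ need not have the same cardinality. Here $n\ge 2$, logarithms are in base $2$, and the asymptotic notation is with $p,q,c$ fixed: the implied constants do not depend on $n$, $k$, or the inputs (in the last bound $O(k\log n)$ the constant may depend on $q$ and $c$). -}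

module Defs where

open import Data.Bool.Base using (Bool)
open import Data.Fin.Base using (Fin)
open import Data.Fin.Properties using (_<?_)
open import Data.Fin.Subset using (Subset; Empty; ⋃; ∣_∣; _∈_; _∩_)
import Data.Integer.Base as ℤ
open import Data.List.Base as List using ()
open import Data.Nat.Base using (ℕ; suc; _≤_; _<_; _^_)
open import Data.Product.Base using (∃; ∃-syntax; _×_)
open import Data.Rational.Base as ℚ using (ℚ)
open import Data.Sum.Base using (_⊎_)
open import Data.Vec.Base as Vec using ()
open import Function.Bundles using (_⇔_)
open import Relation.Binary.PropositionalEquality using (_≢_)
open import Relation.Nullary using (¬_; does)

-- Dedekind reals: Lower r means r < x, and Upper r means x < r.
record ℝ : Set₁ where
  field
    Lower Upper     : ℚ → Set
    lower-inhabited : ∃ Lower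
    upper-inhabited : ∃ Upper
    lower-rounded   : ∀ r → Lower r ⇔ (∃[ s ] (r ℚ.< s × Lower s))
    upper-rounded   : ∀ r → Upper r ⇔ (∃[ s ] (s ℚ.< r × Upper s))
    disjoint        : ∀ r → ¬ (Lower r × Upper r)
    located         : ∀ {r s} → r ℚ.< s → Lower r ⊎ Upper s

open ℝ public using (Lower; Upper)

fromℕ : ℕ → ℚ
fromℕ m = ℤ.+ m ℚ./ 1

infix 4 _<ℝ_ _≤ℝ_

_<ℝ_ : ℕ → ℝ → Set
m <ℝ x = Lower x (fromℕ m)

_≤ℝ_ : ℝ → ℕ → Set
x ≤ℝ m = ¬ Lower x (fromℕ m)

-- x m ≤ t, since x m is the supremum of the r m with r < x.
Multiple≤ : ℝ → ℕ → ℕ → Set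
Multiple≤ x m t = ∀ r → Lower x r → r ℚ.* fromℕ m ℚ.≤ fromℕ t

-- t ≤ x m, since x m is the infimum of the r m with x < r.
≤Multiple : ℕ → ℝ → ℕ → Set
≤Multiple t x m = ∀ r → Upper x r → fromℕ t ℚ.≤ r ℚ.* fromℕ m

-- ℓ = ⌈log₂ (a / x)⌉, for real 0 < x ≤ a: the least ℓ with log₂ (a / x) ≤ ℓ,
-- where log₂ (a / x) ≤ m unfolds to a ≤ x 2ᵐ.
IsCeilLog₂Quotient : ℕ → ℝ → ℕ → Set
IsCeilLog₂Quotient a x ℓ =
  ≤Multiple a x (2 ^ ℓ) × (∀ m → ≤Multiple a x (2 ^ m) → ℓ ≤ m)

-- The element i : Fin n stands for toℕ i + 1 in [n] = {1, …, n}.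

module _ {n : ℕ} where

  AmongTop : ℕ → Subset n → Fin n → Set
  AmongTop i S x = x ∈ S × ∣ S ∩ Vec.tabulate (λ y → does (x <? y)) ∣ < i

  AmongBottom : ℕ → Subset n → Fin n → Set
  AmongBottom j S x = x ∈ S × ∣ S ∩ Vec.tabulate (λ y → does (y <? x)) ∣ < j

  Mediocre : ℕ → ℕ → Subset n → Fin n → Set
  Mediocre i j S x = x ∈ S × ¬ AmongTop i S x × ¬ AmongBottom j S x

  union : ∀ {k} → (Fin k → Subset n) → Subset n
  union A = ⋃ (List.tabulate A)

  PairwiseDisjoint : ∀ {k} → (Fin k → Subset n) → Set
  PairwiseDisjoint A = ∀ i j → i ≢ j → Empty (A i ∩ A j)

-- Deterministic blackboard protocols for k players, each with a private input
-- in X.  A node corresponds to the transcript so far, so the next speaker and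
-- the output depend on the transcript only.  A longer message is a run of
-- single bits by one speaker.
data Protocol (k : ℕ) (X Z : Set) : Set where
  output : Z → Protocol k X Z
  speak  : Fin k → (X → Bool) → (Bool → Protocol k X Z) → Protocol k X Z

module _ {k : ℕ} {X Z : Set} where

  result : Protocol k X Z → (Fin k → X) → Z
  result (output z)         x = z
  result (speak i bit next) x = result (next (bit (x i))) x

  bits : Protocol k X Z → (Fin k → X) → ℕ
  bits (output z)         x = 0
  bits (speak i bit next) x = suc (bits (next (bit (x i))) x)

  Computes : ((Fin k → X) → Set) → ((Fin k → X) → Z → Set) → Protocol k X Z → Set
  Computes Admissible Correct π = ∀ x → Admissible x → Correct x (result π x)

  Complexity≤ : ((Fin k → X) → Set) → Protocol k X Z → ℕ → Set
  Complexity≤ Admissible π b = ∀ x → Admissible x → bits π x ≤ b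

Admissible : (c : ℝ) {n k : ℕ} → (Fin k → Subset n) → Set
Admissible c {n} A = PairwiseDisjoint A × Multiple≤ c n ∣ union A ∣

{-# OPTIONS --safe #-}

-- Write f v for the number of elements of the union below v; the players can
-- compute f v by announcing their own counts.  Put w = ⌈n / 2^ℓ⌉ and
-- s = ⌊αt⌋.  After ℓ halvings of [0, w 2^ℓ) a window [v, v + w) is left with
-- f v < s + w ≤ f (v + w).  As f grows by at most one per step, every element
-- of the union in this window has at least s smaller elements, and at least
-- t + 1 - s - 2w larger ones.  The definition of ℓ gives 2qn ≤ 2^ℓ t, and
-- w - 1 < n / 2^ℓ, so 2 (s + w - 1) < t and the second number is at least s
-- as well.  The window is not empty, so one more announcement finds such an
-- element.
module Submission where

open import Defs
open import Data.Bool.Base using (true; false; if_then_else_)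
open import Data.Fin.Base using (Fin; zero; suc; toℕ; fromℕ<)
open import Data.Fin.Properties using (_<?_; toℕ<n; toℕ-injective; any?)
open import Data.Fin.Subset using (Subset; ∣_∣; _∈_; _∩_; _∪_; Empty; inside; outside)
open import Data.Fin.Subset.Properties
  using (_∈?_; ∉⊥; x∈p∪q⁻; x∈p∪q⁺; x∈p∩q⁺; x∈p∩q⁻; drop-∷-Empty; ∣p∣≤n; ∣p∩q∣≤∣p∣;
         ∣⊥∣≡0; ∩-zeroˡ)
import Data.Integer.Base as ℤ
import Data.Integer.Properties as ℤ
open import Data.List.Base as List using (List; []; _∷_)
import Data.List.Membership.DecPropositional as DecMembership
import Data.List.Membership.Propositional as List
open import Data.List.Membership.Propositional.Properties using (∈-tabulate⁺; ∈-tabulate⁻)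
open import Data.Nat.Base
open import Data.Nat.DivMod using (_/_; _%_; m/n*n≤m; m≡m%n+[m/n]*n; m%n<n)
open import Data.Nat.ListAction using (sum)
open import Data.Nat.Logarithm using (⌊log₂_⌋; ⌊log₂⌋-mono-≤; ⌊log₂[2^n]⌋≡n)
open import Data.Nat.Properties hiding (_<?_)
open import Data.Nat.Tactic.RingSolver using (solve-∀)
open import Data.Product.Base using (∃; ∃-syntax; Σ-syntax; _×_; _,_; proj₁; proj₂)
import Data.Rational.Base as ℚ
import Data.Rational.Properties as ℚ
import Data.Rational.Unnormalised.Base as ℚᵘ
import Data.Rational.Unnormalised.Properties as ℚᵘ
open import Data.Sum.Base using (_⊎_; inj₁; inj₂)
open import Data.Vec.Base as Vec using ([]; _∷_; here; there)
open import Function.Base using (_∘_; id)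
open import Function.Bundles using (Equivalence)
open import Relation.Binary.PropositionalEquality
open import Relation.Nullary using (¬_; Dec; yes; no; does; ofʸ; ofⁿ; contradiction)
open import Relation.Nullary.Decidable using (_×-dec_)

-- Composition of protocols

module _ {k : ℕ} {X : Set} where

  infixl 1 _>>=_

  _>>=_ : {Y Z : Set} → Protocol k X Y → (Y → Protocol k X Z) → Protocol k X Z
  output y         >>= κ = κ y
  speak i bit next >>= κ = speak i bit λ d → next d >>= κ

  result->>= : {Y Z : Set} (π : Protocol k X Y) (κ : Y → Protocol k X Z) → ∀ x →
               result (π >>= κ) x ≡ result (κ (result π x)) x
  result->>= (output y)         κ x = refl
  result->>= (speak i bit next) κ x = result->>= (next (bit (x i))) κ x

  bits->>= : {Y Z : Set} (π : Protocol k X Y) (κ : Y → Protocol k X Z) → ∀ x →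
             bits (π >>= κ) x ≡ bits π x + bits (κ (result π x)) x
  bits->>= (output y)         κ x = refl
  bits->>= (speak i bit next) κ x = cong suc (bits->>= (next (bit (x i))) κ x)

  -- Binary expansion of fixed length, most significant bit first. The fixed length tells all
  -- players where a message ends and makes its cost the same for every input.
  send : Fin k → ℕ → (X → ℕ) → Protocol k X ℕ
  send i zero    f = output 0
  send i (suc b) f = speak i (λ x → 2 ^ b ≤ᵇ f x) λ where
    true  → send i b (λ x → f x ∸ 2 ^ b) >>= λ v → output (2 ^ b + v)
    false → send i b f

  result-send : ∀ i b f x → f (x i) < 2 ^ b → result (send i b f) x ≡ f (x i)
  result-send i zero    f x f<1 = sym (n<1⇒n≡0 f<1)
  result-send i (suc b) f x f<2^1+b with 2 ^ b ≤ᵇ f (x i) | ≤ᵇ-reflects-≤ (2 ^ b) (f (x i))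
  ... | false | ofⁿ 2^b≰f = result-send i b f x (≰⇒> 2^b≰f)
  ... | true  | ofʸ 2^b≤f = begin
    result (send i b g >>= λ v → output (2 ^ b + v)) x  ≡⟨ result->>= (send i b g) _ x ⟩
    2 ^ b + result (send i b g) x                      ≡⟨ cong (2 ^ b +_) (result-send i b g x g<2^b) ⟩
    2 ^ b + g (x i)                                    ≡⟨ m+[n∸m]≡n 2^b≤f ⟩
    f (x i)                                            ∎
    where
    open ≡-Reasoning
    g = λ y → f y ∸ 2 ^ b
    g<2^b : g (x i) < 2 ^ b
    g<2^b = +-cancelˡ-< (2 ^ b) _ _
      (subst₂ _<_ (sym (m+[n∸m]≡n 2^b≤f)) (cong (2 ^ b +_) (+-identityʳ _)) f<2^1+b)

  bits-send : ∀ i b f x → bits (send i b f) x ≡ b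
  bits-send i zero    f x = refl
  bits-send i (suc b) f x with 2 ^ b ≤ᵇ f (x i)
  ... | false = cong suc (bits-send i b f x)
  ... | true  = cong suc (trans (bits->>= (send i b _) _ x)
                         (trans (+-identityʳ _) (bits-send i b _ x)))

  -- The map `g` lists the players still to speak, so the recursion can shorten this list while the
  -- number `k` of players stays fixed.
  poll : ∀ {m} → (Fin m → Fin k) → ℕ → (X → ℕ) → Protocol k X (List ℕ)
  poll {zero}  g b f = output []
  poll {suc m} g b f =
    send (g zero) b f  >>= λ v →
    poll (g ∘ suc) b f >>= λ vs →
    output (v ∷ vs)

  result-poll : ∀ {m} (g : Fin m → Fin k) b f x → (∀ i → f (x i) < 2 ^ b) →
                result (poll g b f) x ≡ List.tabulate (f ∘ x ∘ g)
  result-poll {zero}  g b f x f<2^b = refl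
  result-poll {suc m} g b f x f<2^b = begin
    result (poll g b f) x
      ≡⟨ result->>= (send (g zero) b f) _ x ⟩
    result (poll (g ∘ suc) b f >>= λ vs → output (result (send (g zero) b f) x ∷ vs)) x
      ≡⟨ result->>= (poll (g ∘ suc) b f) _ x ⟩
    result (send (g zero) b f) x ∷ result (poll (g ∘ suc) b f) x
      ≡⟨ cong₂ _∷_ (result-send (g zero) b f x (f<2^b (g zero))) (result-poll (g ∘ suc) b f x f<2^b) ⟩
    List.tabulate (f ∘ x ∘ g)
      ∎
    where open ≡-Reasoning

  bits-poll : ∀ {m} (g : Fin m → Fin k) b f x → bits (poll g b f) x ≡ m * b
  bits-poll {zero}  g b f x = refl
  bits-poll {suc m} g b f x = begin
    bits (poll g b f) x
      ≡⟨ bits->>= (send (g zero) b f) _ x ⟩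
    bits (send (g zero) b f) x + bits (poll (g ∘ suc) b f >>= _) x
      ≡⟨ cong₂ _+_ (bits-send (g zero) b f x) (bits->>= (poll (g ∘ suc) b f) _ x) ⟩
    b + (bits (poll (g ∘ suc) b f) x + 0)
      ≡⟨ cong (b +_) (trans (+-identityʳ _) (bits-poll (g ∘ suc) b f x)) ⟩
    b + m * b
      ∎
    where open ≡-Reasoning

-- Counting the elements below a threshold

-- With this test `below (toℕ x)` is, by computation, the set in `AmongBottom`. The threshold is a
-- natural number because a window may end beyond n.
below : ∀ {n} → ℕ → Subset n
below v = Vec.tabulate λ y → does (suc (toℕ y) ≤? v)

above : ∀ {n} → Fin n → Subset n
above x = Vec.tabulate λ y → does (x <? y)

rank : ∀ {n} → Subset n → ℕ → ℕ
rank S v = ∣ S ∩ below v ∣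

rank-zero : ∀ {n} (S : Subset n) → rank S 0 ≡ 0
rank-zero []            = refl
rank-zero (outside ∷ S) = rank-zero S
rank-zero (inside  ∷ S) = rank-zero S

rank-suc : ∀ {n} (S : Subset n) v → rank S (suc v) ≤ suc (rank S v)
rank-suc []            v       = z≤n
rank-suc (outside ∷ S) zero    = m≤n⇒m≤1+n ≤-refl
rank-suc (inside  ∷ S) zero    = ≤-refl
rank-suc (outside ∷ S) (suc v) = rank-suc S v
rank-suc (inside  ∷ S) (suc v) = s≤s (rank-suc S v)

rank-+ : ∀ {n} (S : Subset n) v d → rank S (v + d) ≤ rank S v + d
rank-+ S v zero    = ≤-reflexive (trans (cong (rank S) (+-identityʳ v)) (sym (+-identityʳ _)))
rank-+ S v (suc d) = begin
  rank S (v + suc d)   ≡⟨ cong (rank S) (+-suc v d) ⟩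
  rank S (suc (v + d)) ≤⟨ rank-suc S (v + d) ⟩
  suc (rank S (v + d)) ≤⟨ s≤s (rank-+ S v d) ⟩
  suc (rank S v + d)   ≡⟨ +-suc _ d ⟨
  rank S v + suc d     ∎
  where open ≤-Reasoning

rank-mono-≤ : ∀ {n} (S : Subset n) {u v} → u ≤ v → rank S u ≤ rank S v
rank-mono-≤ S             z≤n       = ≤-trans (≤-reflexive (rank-zero S)) z≤n
rank-mono-≤ []            (s≤s u≤v) = z≤n
rank-mono-≤ (outside ∷ S) (s≤s u≤v) = rank-mono-≤ S u≤v
rank-mono-≤ (inside  ∷ S) (s≤s u≤v) = s≤s (rank-mono-≤ S u≤v)

rank-full : ∀ {n} (S : Subset n) {v} → n ≤ v → rank S v ≡ ∣ S ∣
rank-full []            _         = refl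
rank-full (outside ∷ S) (s≤s n≤v) = rank-full S n≤v
rank-full (inside  ∷ S) (s≤s n≤v) = cong suc (rank-full S n≤v)

rank-≤ : ∀ {n} (S : Subset n) v → rank S v ≤ n
rank-≤ S v = ≤-trans (∣p∩q∣≤∣p∣ S (below v)) (∣p∣≤n S)

∩-all : ∀ {n} (S : Subset n) → ∣ S ∩ Vec.tabulate (λ _ → true) ∣ ≡ ∣ S ∣
∩-all []            = refl
∩-all (outside ∷ S) = ∩-all S
∩-all (inside  ∷ S) = cong suc (∩-all S)

-- The threshold `suc (toℕ x)` puts x itself on the lower side, so the two parts cover everything,
-- whether or not x lies in S.
rank+above : ∀ {n} (S : Subset n) x → rank S (suc (toℕ x)) + ∣ S ∩ above x ∣ ≡ ∣ S ∣
rank+above (outside ∷ S) zero    = cong₂ _+_ (rank-zero S) (∩-all S)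
rank+above (inside  ∷ S) zero    = cong suc (cong₂ _+_ (rank-zero S) (∩-all S))
rank+above (outside ∷ S) (suc x) = rank+above S x
rank+above (inside  ∷ S) (suc x) = cong suc (rank+above S x)

Window : ∀ {n} → ℕ → ℕ → Subset n → Fin n → Set
Window u v S y = y ∈ S × u ≤ toℕ y × toℕ y < v

-- Positions are stripped from the front. As long as u is positive, a member at the front counts in
-- both ranks and cancels; once u is 0, the first member met is the witness.
rank-<⇒Window : ∀ {n} (S : Subset n) u v → rank S u < rank S v → ∃ (Window u v S)
rank-<⇒Window []            u       v       ()
rank-<⇒Window (b ∷ S)       u       zero    lt =
  contradiction (subst (rank (b ∷ S) u <_) (rank-zero (b ∷ S)) lt) n≮0
rank-<⇒Window (inside  ∷ S) zero    (suc v) lt = zero , here , z≤n , z<s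
rank-<⇒Window (outside ∷ S) zero    (suc v) lt with rank-<⇒Window S 0 v lt
... | y , y∈S , _ , y<v = suc y , there y∈S , z≤n , s<s y<v
rank-<⇒Window (outside ∷ S) (suc u) (suc v) lt with rank-<⇒Window S u v lt
... | y , y∈S , u≤y , y<v = suc y , there y∈S , s≤s u≤y , s<s y<v
rank-<⇒Window (inside  ∷ S) (suc u) (suc v) lt with rank-<⇒Window S u v (s<s⁻¹ lt)
... | y , y∈S , u≤y , y<v = suc y , there y∈S , s≤s u≤y , s<s y<v

-- Unions of disjoint sets

∣[p∪q]∩r∣ : ∀ {n} (p q r : Subset n) → Empty (p ∩ q) → ∣ (p ∪ q) ∩ r ∣ ≡ ∣ p ∩ r ∣ + ∣ q ∩ r ∣
∣[p∪q]∩r∣ []            []            []            e = refl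
∣[p∪q]∩r∣ (inside  ∷ p) (inside  ∷ q) (_       ∷ r) e = contradiction (zero , here) e
∣[p∪q]∩r∣ (outside ∷ p) (outside ∷ q) (_       ∷ r) e = ∣[p∪q]∩r∣ p q r (drop-∷-Empty e)
∣[p∪q]∩r∣ (outside ∷ p) (inside  ∷ q) (outside ∷ r) e = ∣[p∪q]∩r∣ p q r (drop-∷-Empty e)
∣[p∪q]∩r∣ (outside ∷ p) (inside  ∷ q) (inside  ∷ r) e =
  trans (cong suc (∣[p∪q]∩r∣ p q r (drop-∷-Empty e))) (sym (+-suc ∣ p ∩ r ∣ ∣ q ∩ r ∣))
∣[p∪q]∩r∣ (inside  ∷ p) (outside ∷ q) (outside ∷ r) e = ∣[p∪q]∩r∣ p q r (drop-∷-Empty e)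
∣[p∪q]∩r∣ (inside  ∷ p) (outside ∷ q) (inside  ∷ r) e = cong suc (∣[p∪q]∩r∣ p q r (drop-∷-Empty e))

x∈union⁺ : ∀ {n k x} (A : Fin k → Subset n) i → x ∈ A i → x ∈ union A
x∈union⁺ A zero    x∈A = x∈p∪q⁺ (inj₁ x∈A)
x∈union⁺ A (suc i) x∈A = x∈p∪q⁺ (inj₂ (x∈union⁺ (A ∘ suc) i x∈A))

x∈union⁻ : ∀ {n k x} (A : Fin k → Subset n) → x ∈ union A → ∃[ i ] x ∈ A i
x∈union⁻ {k = zero}  A x∈⊥ = contradiction x∈⊥ ∉⊥
x∈union⁻ {k = suc k} A x∈∪ with x∈p∪q⁻ (A zero) (union (A ∘ suc)) x∈∪
... | inj₁ x∈A  = zero , x∈A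
... | inj₂ x∈∪′ with x∈union⁻ (A ∘ suc) x∈∪′
...   | i , x∈A = suc i , x∈A

-- Here the disjointness of the inputs enters: an element held by two players would be counted twice
-- in the sum of the announced counts.
rank-union : ∀ {n k} (A : Fin k → Subset n) → PairwiseDisjoint A → ∀ v →
             sum (List.tabulate λ i → rank (A i) v) ≡ rank (union A) v
rank-union {n} {zero}  A disj v = sym (trans (cong (∣_∣ {n}) (∩-zeroˡ (below v))) (∣⊥∣≡0 n))
rank-union {n} {suc k} A disj v = begin
  rank (A zero) v + sum (List.tabulate λ i → rank (A (suc i)) v)
    ≡⟨ cong (rank (A zero) v +_) (rank-union (A ∘ suc) (λ i j i≢j → disj (suc i) (suc j) (λ where refl → i≢j refl)) v) ⟩
  rank (A zero) v + rank (union (A ∘ suc)) v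
    ≡⟨ ∣[p∪q]∩r∣ (A zero) (union (A ∘ suc)) (below v) A₀∩rest ⟨
  rank (union A) v
    ∎
  where
  open ≡-Reasoning
  A₀∩rest : Empty (A zero ∩ union (A ∘ suc))
  A₀∩rest (x , x∈∩) with x∈p∩q⁻ (A zero) _ x∈∩
  ... | x∈A₀ , x∈rest with x∈union⁻ (A ∘ suc) x∈rest
  ...   | i , x∈Aᵢ = disj zero (suc i) (λ ()) (x , x∈p∩q⁺ (x∈A₀ , x∈Aᵢ))

-- Announcing an element of the window

window? : ∀ {n} u v (S : Subset n) → Dec (∃ (Window u v S))
window? u v S = any? λ y → y ∈? S ×-dec u ≤? toℕ y ×-dec suc (toℕ y) ≤? v

-- The value n means that the window contains no element of S.
pick : ∀ {n} → ℕ → ℕ → Subset n → ℕ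
pick {n} u v S with window? u v S
... | yes (y , _) = toℕ y
... | no  _       = n

-- The bound n is attained when there is nothing to announce, so a message must be able to carry n
-- itself; this is why `n < 2 ^ b` is demanded later.
pick-≤ : ∀ {n} u v (S : Subset n) → pick u v S ≤ n
pick-≤ u v S with window? u v S
... | yes (y , _) = <⇒≤ (toℕ<n y)
... | no  _       = ≤-refl

-- Being of the form `toℕ x`, the announced number is smaller than n and cannot be the value
-- reserved for an empty window.
pick-sound : ∀ {n} u v (S : Subset n) {x} → toℕ x ≡ pick u v S → Window u v S x
pick-sound u v S {x} eq with window? u v S
... | yes (y , y∈S , u≤y , y<v) rewrite toℕ-injective eq = y∈S , u≤y , y<v
... | no  _ = contradiction eq (<⇒≢ (toℕ<n x))

pick-complete : ∀ {n} u v (S : Subset n) → ∃ (Window u v S) → ∃[ y ] toℕ y ≡ pick u v S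
pick-complete u v S w with window? u v S
... | yes (y , _) = y , refl
... | no  ∄w      = contradiction w ∄w

-- Searching through `Fin n` instead of the list passes over the reserved value n. The default only
-- serves transcripts in which nobody announces an element.
select : ∀ {n} → Fin n → List ℕ → Fin n
select {n} default vs with any? {n} (λ y → DecMembership._∈?_ _≟_ (toℕ y) vs)
... | yes (y , _) = y
... | no  _       = default

toℕ-select-∈ : ∀ {n} (default : Fin n) vs → (∃[ y ] toℕ {n} y List.∈ vs) →
               toℕ (select default vs) List.∈ vs
toℕ-select-∈ {n} default vs y∈vs with any? {n} (λ y → DecMembership._∈?_ _≟_ (toℕ y) vs)
... | yes (y , y∈) = y∈
... | no  ∄y       = contradiction y∈vs ∄y

-- Binary search

module _ {n k : ℕ} (b : ℕ) where

  count : ℕ → Protocol k (Subset n) ℕ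
  count v = poll id b (λ S → rank S v) >>= output ∘ sum

  bits-count : ∀ v A → bits (count v) A ≡ k * b
  bits-count v A = trans (bits->>= (poll id b _) _ A)
                  (trans (+-identityʳ _) (bits-poll id b _ A))

  -- With `j` rounds left the search interval is `[u , u + w * 2 ^ j)`. Widths of this form are
  -- halved exactly, so no rounding has to be tracked.
  binarySearch : (m w j u : ℕ) → Protocol k (Subset n) ℕ
  binarySearch m w zero    u = output u
  binarySearch m w (suc j) u = count (u + w * 2 ^ j) >>= λ r →
    if m ≤ᵇ r then binarySearch m w j u else binarySearch m w j (u + w * 2 ^ j)

  bits-binarySearch : ∀ m w j u A → bits (binarySearch m w j u) A ≡ j * (k * b)
  bits-binarySearch m w zero    u A = refl
  bits-binarySearch m w (suc j) u A =
    trans (bits->>= (count (u + w * 2 ^ j)) _ A)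
          (cong₂ _+_ (bits-count (u + w * 2 ^ j) A) (branch (result (count (u + w * 2 ^ j)) A)))
    where
    branch : ∀ r → bits (if m ≤ᵇ r then binarySearch m w j u
                         else binarySearch m w j (u + w * 2 ^ j)) A ≡ j * (k * b)
    branch r with m ≤ᵇ r
    ... | true  = bits-binarySearch m w j u A
    ... | false = bits-binarySearch m w j (u + w * 2 ^ j) A

  announce : Fin n → (u w : ℕ) → Protocol k (Subset n) (Fin n)
  announce default u w = poll id b (pick u (u + w)) >>= output ∘ select default

  -- The size t of the union depends on the joint input, so it is counted first, and `s` is a
  -- function to be applied to the outcome.
  findMediocre : Fin n → (w j : ℕ) → (ℕ → ℕ) → Protocol k (Subset n) (Fin n)
  findMediocre default w j s =
    count n                      >>= λ t →
    binarySearch (s t + w) w j 0 >>= λ u →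
    announce default u w

  -- One round finds t, `j` rounds halve the interval and one announces an element; in each round
  -- every player sends `b` bits.
  bits-findMediocre : ∀ default w j s A → bits (findMediocre default w j s) A ≡ (2 + j) * (k * b)
  bits-findMediocre default w j s A = begin
    bits (findMediocre default w j s) A
      ≡⟨ bits->>= (count n) _ A ⟩
    bits (count n) A + bits (search >>= λ u → announce default u w) A
      ≡⟨ cong (bits (count n) A +_) (bits->>= search _ A) ⟩
    bits (count n) A + (bits search A + bits (announce default u w) A)
      ≡⟨ cong₂ _+_ (bits-count n A) (cong₂ _+_ (bits-binarySearch _ w j 0 A)
           (trans (bits->>= (poll id b (pick u (u + w))) _ A)
             (trans (+-identityʳ _) (bits-poll id b _ A)))) ⟩
    k * b + (j * (k * b) + k * b)
      ≡⟨ cong (k * b +_) (+-comm (j * (k * b)) (k * b)) ⟩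
    (2 + j) * (k * b)
      ∎
    where
    open ≡-Reasoning
    search = binarySearch (s (result (count n) A) + w) w j 0
    u      = result search A

  module _ (n<2^b : n < 2 ^ b) (A : Fin k → Subset n) (disjoint : PairwiseDisjoint A) where

    result-count : ∀ v → result (count v) A ≡ rank (union A) v
    result-count v = begin
      result (count v) A                           ≡⟨ result->>= (poll id b _) _ A ⟩
      sum (result (poll id b (λ S → rank S v)) A)  ≡⟨ cong sum (result-poll id b _ A λ i → ≤-<-trans (rank-≤ (A i) v) n<2^b) ⟩
      sum (List.tabulate λ i → rank (A i) v)       ≡⟨ rank-union A disjoint v ⟩
      rank (union A) v                             ∎
      where open ≡-Reasoning

    Brackets : (m u v : ℕ) → Set
    Brackets m u v = rank (union A) u < m × m ≤ rank (union A) v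

    -- The comparison at the midpoint makes it a valid right end or a valid left end; the opposite
    -- end is kept together with its inequality.
    binarySearch-brackets : ∀ m w j u → Brackets m u (u + w * 2 ^ j) →
      let u′ = result (binarySearch m w j u) A in Brackets m u′ (u′ + w)
    binarySearch-brackets m w zero    u (lo , hi) =
      lo , subst (λ d → m ≤ rank (union A) (u + d)) (*-identityʳ w) hi
    binarySearch-brackets m w (suc j) u (lo , hi)
      rewrite result->>= (count (u + w * 2 ^ j))
                (λ r → if m ≤ᵇ r then binarySearch m w j u
                       else binarySearch m w j (u + w * 2 ^ j)) A
            | result-count (u + w * 2 ^ j)
      with m ≤ᵇ rank (union A) (u + w * 2 ^ j) | ≤ᵇ-reflects-≤ m (rank (union A) (u + w * 2 ^ j))
    ... | true  | ofʸ m≤r = binarySearch-brackets m w j u (lo , m≤r)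
    ... | false | ofⁿ m≰r = binarySearch-brackets m w j (u + w * 2 ^ j)
      (≰⇒> m≰r , subst (λ v → m ≤ rank (union A) v) (split u w (2 ^ j)) hi)
      where
      split : ∀ u w x → u + w * (2 * x) ≡ u + w * x + w * x
      split = solve-∀

    -- The growth of the rank yields some element of the union in the window, and its owner
    -- therefore announces a genuine element. So `select` returns an announced number, possibly from
    -- another player, and any such number is sound.
    announce-Window : ∀ default u w → rank (union A) u < rank (union A) (u + w) →
                      Window u (u + w) (union A) (result (announce default u w) A)
    announce-Window default u w lt
      rewrite result->>= (poll id b (pick u (u + w))) (output ∘ select default) A
            | result-poll id b (pick u (u + w)) A (λ i → ≤-<-trans (pick-≤ u (u + w) (A i)) n<2^b)
      with rank-<⇒Window (union A) u (u + w) lt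
    ... | y , y∈∪ , u≤y , y<v with x∈union⁻ A y∈∪
    ... | i , y∈Aᵢ with pick-complete u (u + w) (A i) (y , y∈Aᵢ , u≤y , y<v)
    ... | z , z≡pick with ∈-tabulate⁻ {f = picks} (toℕ-select-∈ default (List.tabulate picks)
                            (z , subst (List._∈ List.tabulate picks) (sym z≡pick) (∈-tabulate⁺ {f = picks} i)))
      where picks = λ i → pick u (u + w) (A i)
    ... | i′ , x≡pick with pick-sound u (u + w) (A i′) x≡pick
    ... | x∈Aᵢ , u≤x , x<v = x∈union⁺ A i′ x∈Aᵢ , u≤x , x<v

-- From the final window to a mediocre element

Window⇒Mediocre : ∀ {n} (S : Subset n) s d u {x} →
  rank S u < s + suc d → s + suc d ≤ rank S (u + suc d) → 2 * (s + d) < ∣ S ∣ →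
  Window u (u + suc d) S x → Mediocre s s S x
Window⇒Mediocre S s d u {x} lo hi small (x∈S , u≤x , x<v) =
  x∈S , (λ (_ , few) → <⇒≱ few enoughAbove) , (λ (_ , few) → <⇒≱ few enoughBelow)
  where
  open ≤-Reasoning
  w = suc d

  -- Since `toℕ x + w` is at or past the right end, its rank is at least `s + w`; going back `w`
  -- steps loses at most `w`.
  enoughBelow : s ≤ rank S (toℕ x)
  enoughBelow = +-cancelʳ-≤ w s (rank S (toℕ x)) (begin
    s + w                ≤⟨ hi ⟩
    rank S (u + w)       ≤⟨ rank-mono-≤ S (+-monoˡ-≤ w u≤x) ⟩
    rank S (toℕ x + w)   ≤⟨ rank-+ S (toℕ x) w ⟩
    rank S (toℕ x) + w   ∎)

  -- At most s + 2d + 1 elements lie at or below x, while the whole set has at least 2s + 2d + 1.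
  enoughAbove : s ≤ ∣ S ∩ above x ∣
  enoughAbove = +-cancelˡ-≤ (suc (s + d + d)) s ∣ S ∩ above x ∣ (begin
    suc (s + d + d) + s                       ≡⟨ double s d ⟩
    suc (2 * (s + d))                         ≤⟨ small ⟩
    ∣ S ∣                                     ≡⟨ rank+above S x ⟨
    rank S (suc (toℕ x)) + ∣ S ∩ above x ∣    ≤⟨ +-monoˡ-≤ _ upTo ⟩
    suc (s + d + d) + ∣ S ∩ above x ∣         ∎)
    where
    double : ∀ s d → suc (s + d + d) + s ≡ suc (2 * (s + d))
    double = solve-∀
    shift : ∀ s d → s + suc d + suc d ≡ suc (suc (s + d + d))
    shift = solve-∀
    upTo : rank S (suc (toℕ x)) ≤ suc (s + d + d)
    upTo = s≤s⁻¹ (begin-strict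
      rank S (suc (toℕ x))  ≤⟨ rank-mono-≤ S x<v ⟩
      rank S (u + w)        ≤⟨ rank-+ S u w ⟩
      rank S u + w          <⟨ +-monoˡ-< w lo ⟩
      s + w + w             ≡⟨ shift s d ⟩
      suc (suc (s + d + d)) ∎)

findMediocre-correct : ∀ {n k} b default d j (s : ℕ → ℕ) (A : Fin k → Subset n) →
  n < 2 ^ b → PairwiseDisjoint A → n ≤ suc d * 2 ^ j →
  let t = ∣ union A ∣ in
  2 * (s t + d) < t → Mediocre (s t) (s t) (union A) (result (findMediocre b default (suc d) j s) A)
findMediocre-correct {n} b default d j s A n<2^b disjoint n≤w2^j small
  rewrite result->>= (count b n)
            (λ t → binarySearch b (s t + suc d) (suc d) j 0 >>= λ u → announce b default u (suc d)) A
        | trans (result-count b n<2^b A disjoint n) (rank-full (union A) ≤-refl)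
        | result->>= (binarySearch {n} b (s ∣ union A ∣ + suc d) (suc d) j 0)
            (λ u → announce b default u (suc d)) A
  = Window⇒Mediocre (union A) (s t) d u lo hi small
      (announce-Window b n<2^b A disjoint default u (suc d) (<-≤-trans lo hi))
  where
  open ≤-Reasoning
  t = ∣ union A ∣
  m = s t + suc d
  u = result (binarySearch b m (suc d) j 0) A
  m≤t : m ≤ t
  m≤t = begin
    s t + suc d          ≡⟨ +-suc (s t) d ⟩
    suc (s t + d)        ≤⟨ s≤s (m≤n*m (s t + d) 2) ⟩
    suc (2 * (s t + d))  ≤⟨ small ⟩
    t                    ∎
  -- Initially the left end 0 has rank 0, below the positive target, and the right end is at least
  -- n, so its rank is t, which is at least `m`.
  brackets = binarySearch-brackets b n<2^b A disjoint m (suc d) j 0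
    ( ≤-<-trans (≤-reflexive (rank-zero (union A))) (≤-<-trans z≤n (m<m+n (s t) z<s))
    , ≤-trans m≤t (≤-reflexive (sym (rank-full (union A) n≤w2^j))))
  lo = proj₁ brackets
  hi = proj₂ brackets

-- Eliminating the real number c

-- The operation `ℚ._/_` reduces fractions, so the calculation moves to unnormalised rationals,
-- where equality is cross multiplication.
ratio-* : ∀ a n .{{_ : NonZero n}} → (ℤ.+ a ℚ./ n) ℚ.* fromℕ n ≡ fromℕ a
ratio-* a n@(suc n-1) = ℚ.toℚᵘ-injective (begin
  ℚ.toℚᵘ ((ℤ.+ a ℚ./ n) ℚ.* fromℕ n)
    ≈⟨ ℚ.toℚᵘ-homo-* (ℤ.+ a ℚ./ n) (fromℕ n) ⟩
  ℚ.toℚᵘ (ℤ.+ a ℚ./ n) ℚᵘ.* ℚ.toℚᵘ (fromℕ n)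
    ≈⟨ ℚᵘ.*-cong (ℚ.toℚᵘ-fromℚᵘ (ℚᵘ.mkℚᵘ (ℤ.+ a) n-1)) (ℚ.toℚᵘ-fromℚᵘ (ℚᵘ.mkℚᵘ (ℤ.+ n) 0)) ⟩
  ℚᵘ.mkℚᵘ (ℤ.+ a) n-1 ℚᵘ.* ℚᵘ.mkℚᵘ (ℤ.+ n) 0
    ≈⟨ ℚᵘ.*≡* (ℤ.*-assoc (ℤ.+ a) (ℤ.+ n) (ℤ.+ 1)) ⟩
  ℚᵘ.mkℚᵘ (ℤ.+ a) 0
    ≈⟨ ℚ.toℚᵘ-fromℚᵘ (ℚᵘ.mkℚᵘ (ℤ.+ a) 0) ⟨
  ℚ.toℚᵘ (fromℕ a)
    ∎)
  where open import Relation.Binary.Reasoning.Setoid ℚᵘ.≃-setoid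

ratio-< : ∀ a n b m .{{_ : NonZero n}} .{{_ : NonZero m}} → a * m < b * n →
          ℤ.+ a ℚ./ n ℚ.< ℤ.+ b ℚ./ m
ratio-< a n@(suc n-1) b m@(suc m-1) am<bn = ℚ.toℚᵘ-cancel-<
  (ℚᵘ.<-respˡ-≃ (ℚᵘ.≃-sym (ℚ.toℚᵘ-fromℚᵘ (ℚᵘ.mkℚᵘ (ℤ.+ a) n-1)))
  (ℚᵘ.<-respʳ-≃ (ℚᵘ.≃-sym (ℚ.toℚᵘ-fromℚᵘ (ℚᵘ.mkℚᵘ (ℤ.+ b) m-1)))
  (ℚᵘ.*<* (subst₂ ℤ._<_ (ℤ.pos-* a m) (ℤ.pos-* b n) (ℤ.+<+ am<bn)))))

fromℕ-positive : ∀ n .{{_ : NonZero n}} → ℚ.Positive (fromℕ n)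
fromℕ-positive n = ℚ.normalize-pos n 1

-- If the conclusion failed, then t/n < a/m, and locatedness would put c above t/n or below a/m.
-- Roundedness then gives a rational r strictly between c and that fraction, and r contradicts the
-- corresponding hypothesis.
Multiple≤-≤Multiple : ∀ c n t a m .{{_ : NonZero n}} .{{_ : NonZero m}} →
                      Multiple≤ c n t → ≤Multiple a c m → a * n ≤ t * m
Multiple≤-≤Multiple c n t a m cn≤t a≤cm = ≮⇒≥ λ tm<an →
  notBetween (ℝ.located c (ratio-< t n a m tm<an))
  where
  instance
    n>0 = fromℕ-positive n
    m>0 = fromℕ-positive m
  notBetween : ¬ (Lower c (ℤ.+ t ℚ./ n) ⊎ Upper c (ℤ.+ a ℚ./ m))
  notBetween (inj₁ t/n<c) with Equivalence.to (ℝ.lower-rounded c _) t/n<c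
  ... | r , t/n<r , r<c = ℚ.<-irrefl refl (ℚ.<-≤-trans
    (subst (ℚ._< r ℚ.* fromℕ n) (ratio-* t n) (ℚ.*-monoˡ-<-pos (fromℕ n) t/n<r)) (cn≤t r r<c))
  notBetween (inj₂ c<a/m) with Equivalence.to (ℝ.upper-rounded c _) c<a/m
  ... | r , r<a/m , c<r = ℚ.<-irrefl refl (ℚ.≤-<-trans (a≤cm r c<r)
    (subst (r ℚ.* fromℕ m ℚ.<_) (ratio-* a m) (ℚ.*-monoˡ-<-pos (fromℕ m) r<a/m)))

-- Arithmetic of the parameters

n<2^1+⌊log₂n⌋ : ∀ n → n < 2 ^ suc ⌊log₂ n ⌋
n<2^1+⌊log₂n⌋ n = ≰⇒> λ 2^≤n → 1+n≰n
  (subst (_≤ ⌊log₂ n ⌋) (⌊log₂[2^n]⌋≡n (suc ⌊log₂ n ⌋)) (⌊log₂⌋-mono-≤ 2^≤n))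

-- For positive n the factor `suc (pred n / m)` is the ceiling of n / m, in a form that exhibits its
-- predecessor.
n≤suc[pred[n]/m]*m : ∀ n m .{{_ : NonZero m}} .{{_ : NonZero n}} → n ≤ suc (pred n / m) * m
n≤suc[pred[n]/m]*m (suc n-1) m = begin-strict
  n-1                      ≡⟨ m≡m%n+[m/n]*n n-1 m ⟩
  n-1 % m + n-1 / m * m    <⟨ +-monoˡ-< _ (m%n<n n-1 m) ⟩
  m + n-1 / m * m          ∎
  where open ≤-Reasoning

-- Integrality turns 2p < q into 2p + 1 ≤ q. Of the q copies of t, 2p pay for 2qs, and the one left
-- over pays for 2qd, which is less than t.
slack : ∀ p q t n m d s .{{_ : NonZero q}} .{{_ : NonZero m}} →
        2 * p < q → 2 * q * n ≤ t * m → d * m < n → s * q ≤ p * t → 2 * (s + d) < t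
slack p q t n m d s 2p<q 2qn≤tm dm<n sq≤pt = *-cancelˡ-< q _ _ (begin-strict
  q * (2 * (s + d))            ≡⟨ expand q s d ⟩
  2 * (s * q) + 2 * q * d      <⟨ +-monoʳ-< (2 * (s * q)) 2qd<t ⟩
  2 * (s * q) + t              ≤⟨ +-monoˡ-≤ t (*-monoʳ-≤ 2 sq≤pt) ⟩
  2 * (p * t) + t              ≡⟨ collect p t ⟩
  suc (2 * p) * t              ≤⟨ *-monoˡ-≤ t 2p<q ⟩
  q * t                        ∎)
  where
  open ≤-Reasoning
  expand : ∀ q s d → q * (2 * (s + d)) ≡ 2 * (s * q) + 2 * q * d
  expand = solve-∀
  collect : ∀ p t → 2 * (p * t) + t ≡ suc (2 * p) * t
  collect = solve-∀
  2qd<t : 2 * q * d < t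
  2qd<t = *-cancelʳ-< m _ _ (begin-strict
    2 * q * d * m    ≡⟨ *-assoc (2 * q) d m ⟩
    2 * q * (d * m)  <⟨ *-monoʳ-< (2 * q) {{m*n≢0 2 q}} dm<n ⟩
    2 * q * n        ≤⟨ 2qn≤tm ⟩
    t * m            ∎)

-- The constant is 3 times 2: two extra rounds add at most 2ℓ to ℓ, and one extra bit per message at
-- most doubles L.
bits-≤ : ∀ ℓ k L → 1 ≤ ℓ → 1 ≤ L → (2 + ℓ) * (k * suc L) ≤ 6 * (ℓ * (k * L))
bits-≤ ℓ k L 1≤ℓ 1≤L = begin
  (2 + ℓ) * (k * suc L)        ≤⟨ *-mono-≤ (+-monoˡ-≤ ℓ (*-monoʳ-≤ 2 1≤ℓ)) (*-monoʳ-≤ k (+-monoˡ-≤ L 1≤L)) ⟩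
  (2 * ℓ + ℓ) * (k * (L + L))  ≡⟨ collect ℓ k L ⟩
  6 * (ℓ * (k * L))            ∎
  where
  open ≤-Reasoning
  collect : ∀ ℓ k L → (2 * ℓ + ℓ) * (k * (L + L)) ≡ 6 * (ℓ * (k * L))
  collect = solve-∀

theorem2 : ∃[ C ] ((q : ℕ) .{{_ : NonZero q}} (c : ℝ) → 0 <ℝ c → c ≤ℝ 1 →
    (ℓ : ℕ) → IsCeilLog₂Quotient (2 * q) c ℓ →
    ∃[ D ] ((p : ℕ) .{{_ : NonZero p}} → 2 * p < q →
    (n k : ℕ) → 2 ≤ n →
    Σ[ π ∈ Protocol k (Subset n) (Fin n) ]
    ( Computes (Admissible c)
    (λ A x → let t = ∣ union A ∣ in
    Mediocre ((p * t) / q) ((p * t) / q) (union A) x) π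
    × Complexity≤ (Admissible c) π (C * (ℓ * (k * ⌊log₂ n ⌋)))
    × Complexity≤ (Admissible c) π (D * (k * ⌊log₂ n ⌋)))))
-- The second constant `6 * ℓ` is legitimate because ℓ is determined by q and c and is fixed before
-- p, n and k.
theorem2 = 6 , λ q c _ _ ℓ (2q≤c2^ℓ , _) → 6 * ℓ , λ p 2p<q n k 2≤n →
  let instance
        n≢0 : NonZero n
        n≢0 = >-nonZero (<⇒≤ 2≤n)
        2^ℓ≢0 : NonZero (2 ^ ℓ)
        2^ℓ≢0 = m^n≢0 2 ℓ
      -- The final window has width `suc d`, the ceiling of n / 2^ℓ, and `b` bits suffice for every
      -- number from 0 to n.
      d = pred n / 2 ^ ℓ
      b = suc ⌊log₂ n ⌋
      π = findMediocre b (fromℕ< (<⇒≤ 2≤n)) (suc d) ℓ (λ t → (p * t) / q)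

      2qn≤t2^ℓ : ∀ A → Admissible c A → 2 * q * n ≤ ∣ union {n} {k} A ∣ * 2 ^ ℓ
      2qn≤t2^ℓ A (_ , cn≤t) = Multiple≤-≤Multiple c n ∣ union A ∣ (2 * q) (2 ^ ℓ) cn≤t 2q≤c2^ℓ

      -- For ℓ = 0 the previous bound would give 2qn ≤ t ≤ n.
      1≤ℓ : ∀ A → Admissible c A → 1 ≤ ℓ
      1≤ℓ A adm = n≢0⇒n>0 λ ℓ≡0 → <⇒≱
        (subst (n <_) (*-comm n (2 * q)) (m<m*n n (2 * q) (*-monoʳ-≤ 2 (>-nonZero⁻¹ q))))
        (≤-trans (2qn≤t2^ℓ A adm)
          (subst (λ j → ∣ union A ∣ * 2 ^ j ≤ n) (sym ℓ≡0)
            (≤-trans (≤-reflexive (*-identityʳ _)) (∣p∣≤n (union A)))))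

      cost : Complexity≤ (Admissible c) π (6 * (ℓ * (k * ⌊log₂ n ⌋)))
      cost A adm = subst (_≤ 6 * (ℓ * (k * ⌊log₂ n ⌋)))
        (sym (bits-findMediocre b (fromℕ< (<⇒≤ 2≤n)) (suc d) ℓ (λ t → (p * t) / q) A))
        (bits-≤ ℓ k ⌊log₂ n ⌋ (1≤ℓ A adm) (⌊log₂⌋-mono-≤ 2≤n))
  in π
   , (λ A adm → findMediocre-correct b (fromℕ< (<⇒≤ 2≤n)) d ℓ (λ t → (p * t) / q) A
        (n<2^1+⌊log₂n⌋ n) (proj₁ adm) (n≤suc[pred[n]/m]*m n (2 ^ ℓ))
        (slack p q ∣ union A ∣ n (2 ^ ℓ) d ((p * ∣ union A ∣) / q) 2p<q (2qn≤t2^ℓ A adm)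
          (m≤pred[n]⇒suc[m]≤n (m/n*n≤m (pred n) (2 ^ ℓ))) (m/n*n≤m (p * ∣ union A ∣) q)))
   , cost
   , (λ A adm → subst (bits π A ≤_) (sym (*-assoc 6 ℓ _)) (cost A adm))
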